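{- Let $\mathsf{L}$ and $\mathsf{H}$ be simplicial complexes, and let $\mathsf{A}$, $\mathsf{B}$ be facet subcomplexes of $\mathsf{L}$ such that $\mathsf{L}=\mathsf{A}\cup\mathsf{B}$. Then: (1) $\max\{\mathrm{C}(\mathsf{A};\mathsf{H}),\mathrm{C}(\mathsf{B};\mathsf{H})\}\leq \mathrm{C}(\mathsf{L};\mathsf{H})\leq \mathrm{C}(\mathsf{A};\mathsf{H})+\mathrm{C}(\mathsf{B};\mathsf{H})$. (2) $\max\{\mathrm{IC}(\mathsf{A};\mathsf{H}),\mathrm{IC}(\mathsf{B};\mathsf{H})\}\leq \mathrm{IC}(\mathsf{L};\mathsf{H})\leq \mathrm{IC}(\mathsf{A};\mathsf{H})+\mathrm{IC}(\mathsf{B};\mathsf{H})$.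
   Context: A simplicial complex is an abstract simplicial complex: a set $\mathsf{K}$ of subsets (simplices) of a vertex set $V(\mathsf{K})=\bigcup\mathsf{K}$ such that $F\in\mathsf{K}$ and $G\subseteq F$ imply $G\in\mathsf{K}$. A facet is a simplex that is maximal with respect to inclusion; a facet is non-unitary if it has at least two vertices. A subcomplex of $\mathsf{K}$ is a simplicial complex contained in $\mathsf{K}$. A subcomplex $\mathsf{A}$ of $\mathsf{L}$ is a facet subcomplex if every facet of $\mathsf{A}$ is a facet of $\mathsf{L}$. The union of simplicial complexes is the union of their vertex sets and of their sets of simplices. A simplicial map $f:\mathsf{L}\to\mathsf{K}$ is a map $f:V(\mathsf{L})\to V(\mathsf{K})$ such that $f(F)\in\mathsf{K}$ whenever $F\in\mathsf{L}$; it is injective if it is injective on vertices. A facet simplicial map is a simplicial map $f:\mathsf{L}\to\mathsf{K}$ such that $f(F)$ is a non-unitary facet of $\mathsf{K}$ whenever $F$ is a non-unitary facet of $\mathsf{L}$. The facet-complexity $\mathrm{C}(\mathsf{L};\mathsf{K})$ is the least positive integer $k$ such that there exist subcomplexes $\mathsf{L}_1,\ldots,\mathsf{L}_k$ of $\mathsf{L}$ with $\mathsf{L}=\mathsf{L}_1\cup\cdots\cup\mathsf{L}_k$ and, for each $i$, a facet simplicial map $f_i:\mathsf{L}_i\to\mathsf{K}$; it is $\infty$ if no such $k$ exists. The injective facet-complexity $\mathrm{IC}(\mathsf{L};\mathsf{K})$ is defined in the same way, requiring each $f_i$ to be an injective facet simplicial map. -}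

module Defs where

open import Level using (Level; suc)
open import Axiom.ExcludedMiddle using (ExcludedMiddle)
open import Data.Fin.Base using (Fin)
open import Data.Nat.Base as ℕ using (ℕ)
open import Data.Nat.Induction using (<-rec)
open import Data.Nat.Properties using (≮⇒≥)
open import Data.Product.Base using (∃; ∃₂; Σ-syntax; _×_; _,_; proj₁; proj₂)
open import Data.Sum.Base as Sum using ()
open import Function.Bundles using (Func)
open import Function.Definitions using (Injective)
open import Relation.Binary.Bundles using (Setoid)
import Relation.Binary.Construct.Add.Supremum.NonStrict as NonStrict
import Relation.Binary.Construct.On as On
open import Relation.Binary.PropositionalEquality.Core using (_≡_; _≢_)
open import Relation.Binary.PropositionalEquality.Properties using (setoid)
open import Relation.Nullary.Construct.Add.Supremum using (_⁺; [_]; ⊤⁺)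
open import Relation.Nullary.Decidable.Core using (yes; no)
open import Relation.Unary using (Pred; _∈_; _⊆_; _≐_; _∪_; ⋃)

private variable
  ℓ : Level

-- Subsets of the ambient set V are predicates, so equality of subsets is
-- mutual inclusion.  `downClosed` makes `simplices` invariant under it.
-- Neither finiteness of simplices nor finiteness of the complex is assumed.
record SimplicialComplex {ℓ : Level} (V : Set ℓ) : Set (suc (suc ℓ)) where
  field
    simplices  : Pred (Pred V ℓ) (suc ℓ)
    downClosed : ∀ {F G : Pred V ℓ} → F ∈ simplices → G ⊆ F → G ∈ simplices

open SimplicialComplex public

vertices : {V : Set ℓ} → SimplicialComplex V → Pred V (suc ℓ)
vertices K v = ∃ λ F → F ∈ simplices K × v ∈ F

IsFacet : {V : Set ℓ} → SimplicialComplex V → Pred V ℓ → Set (suc ℓ)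
IsFacet K F = F ∈ simplices K × (∀ {G} → G ∈ simplices K → F ⊆ G → G ⊆ F)

NonUnitary : {V : Set ℓ} → Pred V ℓ → Set ℓ
NonUnitary F = ∃₂ λ u v → u ∈ F × v ∈ F × u ≢ v

infix 4 _⊑_ _≋_

_⊑_ : {V : Set ℓ} → SimplicialComplex V → SimplicialComplex V → Set (suc ℓ)
A ⊑ L = simplices A ⊆ simplices L

_≋_ : {V : Set ℓ} → SimplicialComplex V → SimplicialComplex V → Set (suc ℓ)
K ≋ L = simplices K ≐ simplices L

IsFacetSubcomplex : {V : Set ℓ} → SimplicialComplex V → SimplicialComplex V →
                    Set (suc ℓ)
IsFacetSubcomplex A L = A ⊑ L × (∀ {F} → IsFacet A F → IsFacet L F)

infixr 6 _∪ᶜ_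

_∪ᶜ_ : {V : Set ℓ} →
       SimplicialComplex V → SimplicialComplex V → SimplicialComplex V
(A ∪ᶜ B) .simplices = simplices A ∪ simplices B
(A ∪ᶜ B) .downClosed F∈ G⊆F =
  Sum.map (λ F∈A → downClosed A F∈A G⊆F) (λ F∈B → downClosed B F∈B G⊆F) F∈

⋃ᶜ : {V : Set ℓ} {k : ℕ} → (Fin k → SimplicialComplex V) → SimplicialComplex V
⋃ᶜ {k = k} Ls .simplices = ⋃ (Fin k) (λ i → simplices (Ls i))
⋃ᶜ Ls .downClosed (i , F∈) G⊆F = i , downClosed (Ls i) F∈ G⊆F

-- The set V(K); two elements are equal when the underlying points of V are,
-- irrespective of the simplices witnessing that they are vertices.
vertexSetoid : {V : Set ℓ} → SimplicialComplex V → Setoid (suc ℓ) ℓ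
vertexSetoid {V = V} K =
  On.setoid {B = ∃ (vertices K)} (setoid V) proj₁

VertexMap : {V W : Set ℓ} → SimplicialComplex V → SimplicialComplex W →
            Set (suc ℓ)
VertexMap L K = Func (vertexSetoid L) (vertexSetoid K)

module _ {ℓ : Level} {V W : Set ℓ}
         (L : SimplicialComplex V) (K : SimplicialComplex W) where

  -- f(F) for a simplex F of L: the simplex F itself witnesses that its
  -- elements lie in V(L).
  image : VertexMap L K → {F : Pred V ℓ} → F ∈ simplices L → Pred W ℓ
  image f {F} F∈L w =
    ∃ λ v → Σ[ v∈F ∈ v ∈ F ] proj₁ (Func.to f (v , F , F∈L , v∈F)) ≡ w

  IsSimplicial : VertexMap L K → Set (suc ℓ)
  IsSimplicial f = ∀ {F} (F∈L : F ∈ simplices L) → image f F∈L ∈ simplices K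

  IsFacetSimplicial : VertexMap L K → Set (suc ℓ)
  IsFacetSimplicial f =
    IsSimplicial f ×
    (∀ {F} (F∈L : F ∈ simplices L) → IsFacet L F → NonUnitary F →
       IsFacet K (image f F∈L) × NonUnitary (image f F∈L))

  IsInjective : VertexMap L K → Set (suc ℓ)
  IsInjective f =
    Injective (Setoid._≈_ (vertexSetoid L)) (Setoid._≈_ (vertexSetoid K))
              (Func.to f)

  FacetMap : Set (suc ℓ)
  FacetMap = ∃ λ f → IsFacetSimplicial f

  InjectiveFacetMap : Set (suc ℓ)
  InjectiveFacetMap = ∃ λ f → IsFacetSimplicial f × IsInjective f

ℕ∞ : Set
ℕ∞ = ℕ ⁺

open NonStrict ℕ._≤_ public using () renaming (_≤⁺_ to _≤∞_)

infixl 6 _+∞_ _⊔∞_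

_+∞_ : ℕ∞ → ℕ∞ → ℕ∞
[ m ] +∞ [ n ] = [ m ℕ.+ n ]
[ _ ] +∞ ⊤⁺    = ⊤⁺
⊤⁺    +∞ _     = ⊤⁺

_⊔∞_ : ℕ∞ → ℕ∞ → ℕ∞
[ m ] ⊔∞ [ n ] = [ m ℕ.⊔ n ]
[ _ ] ⊔∞ ⊤⁺    = ⊤⁺
⊤⁺    ⊔∞ _     = ⊤⁺

-- Excluded middle is needed for the least element of an arbitrary nonempty
-- set of naturals, and to decide whether the set is nonempty.

PositiveIn : (ℕ → Set ℓ) → ℕ → Set ℓ
PositiveIn P k = 1 ℕ.≤ k × P k

IsLeastPositive : (ℕ → Set ℓ) → ℕ → Set ℓ
IsLeastPositive P k = PositiveIn P k × (∀ {j} → PositiveIn P j → k ℕ.≤ j)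

findLeast : ExcludedMiddle ℓ → (P : ℕ → Set ℓ) →
            ∃ (PositiveIn P) → ∃ (IsLeastPositive P)
findLeast em P (k₀ , p₀) =
  <-rec (λ k → PositiveIn P k → ∃ (IsLeastPositive P)) step k₀ p₀
  where
  step : ∀ k →
         (∀ {j} → j ℕ.< k → PositiveIn P j → ∃ (IsLeastPositive P)) →
         PositiveIn P k → ∃ (IsLeastPositive P)
  step k rec p with em {P = ∃ λ j → j ℕ.< k × PositiveIn P j}
  ... | yes (_ , j<k , q) = rec j<k q
  ... | no  none          = k , p , λ {j} q → ≮⇒≥ λ j<k → none (j , j<k , q)

leastPositive : ExcludedMiddle ℓ → (ℕ → Set ℓ) → ℕ∞
leastPositive em P with em {P = ∃ (PositiveIn P)}
... | yes p = [ proj₁ (findLeast em P p) ]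
... | no  _ = ⊤⁺

Decomposition : {V : Set ℓ} → SimplicialComplex V →
                (SimplicialComplex V → Set (suc ℓ)) → ℕ → Set (suc (suc ℓ))
Decomposition {V = V} L Q k =
  Σ[ Ls ∈ (Fin k → SimplicialComplex V) ]
    (∀ i → Ls i ⊑ L) × L ≋ ⋃ᶜ Ls × (∀ i → Q (Ls i))

C : {V W : Set ℓ} → ExcludedMiddle (suc (suc ℓ)) →
    SimplicialComplex V → SimplicialComplex W → ℕ∞
C em L K = leastPositive em (Decomposition L (λ Lᵢ → FacetMap Lᵢ K))

IC : {V W : Set ℓ} → ExcludedMiddle (suc (suc ℓ)) →
     SimplicialComplex V → SimplicialComplex W → ℕ∞
IC em L K = leastPositive em (Decomposition L (λ Lᵢ → InjectiveFacetMap Lᵢ K))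

{-# OPTIONS --safe #-}

-- The upper bounds hold because decompositions of A and of B concatenate to one
-- of L.  For the lower bounds, let L be the union of L₁, …, Lₖ.  Since Lᵢ need
-- not be a facet subcomplex of L, a facet of A ∩ Lᵢ need not be one of Lᵢ.
-- Instead let Aᵢ consist of the faces of those simplices of A all of whose
-- cofaces in A belong to Lᵢ.  Facets of Aᵢ are facets of A, hence of L, hence of
-- Lᵢ, so facet maps restrict from Lᵢ to Aᵢ.  The Aᵢ cover A even if A has
-- simplices contained in no facet: a simplex of A outside every Aᵢ could be
-- enlarged k times within A, leaving one Lᵢ each time, to a simplex of A outside
-- all of them.
module Submission where

open import Level using (Level; suc; lift; lower)
open import Axiom.ExcludedMiddle using (ExcludedMiddle)
open import Axiom.DoubleNegationElimination using (em⇒dne)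
open import Data.Fin.Base as Fin using (Fin; zero; splitAt; _↑ˡ_; _↑ʳ_)
open import Data.Fin.Properties using (splitAt-↑ˡ; splitAt-↑ʳ)
open import Data.Nat.Base as ℕ using (ℕ)
open import Data.Nat.Properties using (⊔-lub; ≤-trans; m≤m+n)
open import Data.Product.Base using (∃; _×_; _,_; proj₁; proj₂)
open import Data.Sum.Base using (_⊎_; inj₁; inj₂; [_,_]′)
open import Function.Base using (id; _∘_)
open import Function.Bundles using (Func)
open import Relation.Binary.Construct.Add.Supremum.NonStrict ℕ._≤_
  using ([_]; _≤⊤⁺)
open import Relation.Binary.PropositionalEquality.Core using (subst; sym)
open import Relation.Nullary.Construct.Add.Supremum using (⊤⁺)
open import Relation.Nullary.Decidable.Core using (yes; no; map′)
open import Relation.Nullary.Negation.Core using (contradiction)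
open import Relation.Unary using (Pred; _∈_; _∉_; _⊆_)
open import Defs

private variable
  ℓ : Level
  V : Set ℓ

lowerEM : ExcludedMiddle (suc ℓ) → ExcludedMiddle ℓ
lowerEM em = map′ lower lift em

⊔∞-lub : ∀ {x y z} → x ≤∞ z → y ≤∞ z → x ⊔∞ y ≤∞ z
⊔∞-lub {z = ⊤⁺} _ _ = _ ≤⊤⁺
⊔∞-lub [ m≤o ] [ n≤o ] = [ ⊔-lub m≤o n≤o ]

leastPositive-mono : (em : ExcludedMiddle ℓ) {P Q : ℕ → Set ℓ} →
  (∀ k → Q k → P k) → leastPositive em P ≤∞ leastPositive em Q
leastPositive-mono em {P} {Q} Q⇒P
  with em {P = ∃ (PositiveIn P)} | em {P = ∃ (PositiveIn Q)}
... | _     | no _ = _ ≤⊤⁺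
... | no ¬p | yes (k , 1≤k , q) = contradiction (k , 1≤k , Q⇒P k q) ¬p
... | yes p | yes q with findLeast em P p | findLeast em Q q
... | _ , _ , least | k , (1≤k , qk) , _ = [ least (1≤k , Q⇒P k qk) ]

-- The sum of the two minima is a positive number satisfying `R`, hence bounds the minimum for `R`;
-- if either minimum is infinite, so is the sum.
leastPositive-+ : (em : ExcludedMiddle ℓ) {P Q R : ℕ → Set ℓ} →
  (∀ m n → P m → Q n → R (m ℕ.+ n)) →
  leastPositive em R ≤∞ leastPositive em P +∞ leastPositive em Q
leastPositive-+ em {P} {Q} {R} +-closed
  with em {P = ∃ (PositiveIn P)} | em {P = ∃ (PositiveIn Q)}
... | no _  | _    = _ ≤⊤⁺
... | yes _ | no _ = _ ≤⊤⁺
... | yes p | yes q with findLeast em P p | findLeast em Q q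
... | m , (1≤m , pm) , _ | n , (_ , qn) , _
  with positive ← ≤-trans 1≤m (m≤m+n m n) , +-closed m n pm qn
  with em {P = ∃ (PositiveIn R)}
... | yes r = [ proj₂ (proj₂ (findLeast em R r)) positive ]
... | no ¬r = contradiction (_ , positive) ¬r

-- The complex Aᵢ above, with M in place of Lᵢ.
core : SimplicialComplex V → SimplicialComplex V → SimplicialComplex V
core A M .simplices F = ∃ λ G → G ∈ simplices A × F ⊆ G ×
  (∀ {G′} → G′ ∈ simplices A → G ⊆ G′ → G′ ∈ simplices M)
core A M .downClosed (G , G∈A , F⊆G , star) F′⊆F =
  G , G∈A , F⊆G ∘ F′⊆F , star

module _ {V : Set ℓ} (A M : SimplicialComplex V) where

  core⊑ˡ : core A M ⊑ A
  core⊑ˡ (_ , G∈A , F⊆G , _) = downClosed A G∈A F⊆G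

  core⊑ʳ : core A M ⊑ M
  core⊑ʳ (_ , G∈A , F⊆G , star) = downClosed M (star G∈A id) F⊆G

  -- Such an `F` lies in some `G` whose cofaces in `A` all belong to `M`, and maximality gives
  -- `G ⊆ F`. Every simplex `K` of `A` above `F` then inherits this property from `G`, so it lies in
  -- the core and maximality applies again.
  core-facet : ∀ {F} → IsFacet (core A M) F → IsFacet A F
  core-facet (F∈@(G , G∈A , F⊆G , star) , maximal) = core⊑ˡ F∈ , λ K∈A F⊆K →
    let G⊆F = maximal (G , G∈A , id , star) F⊆G in
    maximal (_ , K∈A , id , λ G′∈A K⊆G′ → star G′∈A (K⊆G′ ∘ F⊆K ∘ G⊆F)) F⊆K

core-isFacetSubcomplex : (A L M : SimplicialComplex V) →
  IsFacetSubcomplex A L → M ⊑ L → IsFacetSubcomplex (core A M) M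
core-isFacetSubcomplex A _ M (_ , facet) M⊑L =
  core⊑ʳ A M , λ F-facet →
    core⊑ʳ A M (proj₁ F-facet) ,
    λ G∈M → proj₂ (facet (core-facet A M F-facet)) (M⊑L G∈M)

module _ {V : Set ℓ} (em : ExcludedMiddle (suc (suc ℓ)))
         (A : SimplicialComplex V) where

  Escape : Pred V ℓ → Pred (Pred V ℓ) (suc ℓ) → Set (suc ℓ)
  Escape F S = ∃ λ G → G ∈ simplices A × F ⊆ G × G ∉ S

  -- If no coface of `F` in `A` leaves `M`, then `F` itself serves as the `G` in `core`.
  core-or-escape : (M : SimplicialComplex V) {F : Pred V ℓ} →
    F ∈ simplices A → F ∈ simplices (core A M) ⊎ Escape F (simplices M)
  core-or-escape M {F} F∈A with lowerEM em {P = Escape F (simplices M)}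
  ... | yes escape = inj₂ escape
  ... | no  ¬escape = inj₁ (F , F∈A , id , λ G∈A F⊆G →
          em⇒dne (lowerEM em) λ G∉M → ¬escape (_ , G∈A , F⊆G , G∉M))

  -- Induction on `k`: an escape `G` from the first complex is passed on to the remaining ones, and
  -- no enlargement of `G` can re-enter the first complex, which is closed under subsets.
  cores-or-escape : ∀ {k} (Ms : Fin k → SimplicialComplex V) {F : Pred V ℓ} →
    F ∈ simplices A →
    F ∈ simplices (⋃ᶜ (core A ∘ Ms)) ⊎ Escape F (simplices (⋃ᶜ Ms))
  -- The empty union has no simplices, so `F` escapes without being enlarged.
  cores-or-escape {ℕ.zero} Ms F∈A = inj₂ (_ , F∈A , id , λ ())
  cores-or-escape {ℕ.suc k} Ms F∈A with core-or-escape (Ms zero) F∈A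
  ... | inj₁ F∈core = inj₁ (zero , F∈core)
  ... | inj₂ (G , G∈A , F⊆G , G∉M₀)
    with cores-or-escape (Ms ∘ Fin.suc) G∈A
  ... | inj₁ (i , G∈core) =
    inj₁ (Fin.suc i , downClosed (core A (Ms (Fin.suc i))) G∈core F⊆G)
  ... | inj₂ (K , K∈A , G⊆K , K∉Ms) = inj₂ (K , K∈A , G⊆K ∘ F⊆G , λ where
    (zero      , K∈M₀) → G∉M₀ (downClosed (Ms zero) K∈M₀ G⊆K)
    (Fin.suc i , K∈Mᵢ) → K∉Ms (i , K∈Mᵢ))

-- Abstracts from the kind of map, so that one argument yields both the plain and the injective
-- bounds.
Hereditary : (SimplicialComplex {ℓ} V → Set (suc ℓ)) → Set (suc (suc ℓ))
Hereditary Q = ∀ A L → IsFacetSubcomplex A L → Q L → Q A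

decomposition-restrict : ExcludedMiddle (suc (suc ℓ)) →
  {V : Set ℓ} (Q : SimplicialComplex V → Set (suc ℓ)) →
  Hereditary Q → ∀ A L → IsFacetSubcomplex A L →
  ∀ k → Decomposition L Q k → Decomposition A Q k
decomposition-restrict em Q her A L A≤L k (Ls , Ls⊑L , (L⊆ , _) , Qs) =
  core A ∘ Ls ,
  (λ i → core⊑ˡ A (Ls i)) ,
  (covers , λ (i , F∈) → core⊑ˡ A (Ls i) F∈) ,
  λ i → her (core A (Ls i)) (Ls i)
    (core-isFacetSubcomplex A L (Ls i) A≤L (Ls⊑L i)) (Qs i)
  where
  covers : A ⊑ ⋃ᶜ (core A ∘ Ls)
  covers F∈A with cores-or-escape em A Ls F∈A
  ... | inj₁ F∈cores = F∈cores
  -- The escaping simplex lies in `A`, hence in `L`, which `Ls` covers.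
  ... | inj₂ (_ , G∈A , _ , G∉) = contradiction (L⊆ (proj₁ A≤L G∈A)) G∉

-- The pieces of `A` and of `B` are already subcomplexes of `L`, so each is kept unchanged together
-- with its proof of `Q`.
decomposition-∪ : {V : Set ℓ} (Q : SimplicialComplex V → Set (suc ℓ))
  (L A B : SimplicialComplex V) → L ≋ A ∪ᶜ B →
  ∀ m n → Decomposition A Q m → Decomposition B Q n →
  Decomposition L Q (m ℕ.+ n)
decomposition-∪ Q L A B (L⊆ , ⊆L) m n
  (As , As⊑A , (A⊆ , _) , QA) (Bs , Bs⊑B , (B⊆ , _) , QB) =
  Ls , Ls⊑L , (covers ∘ L⊆ , λ (i , F∈) → Ls⊑L i F∈) , QL
  where
  Ls : Fin (m ℕ.+ n) → SimplicialComplex _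
  Ls = [ As , Bs ]′ ∘ splitAt m

  Ls⊑L : ∀ i → Ls i ⊑ L
  Ls⊑L i with splitAt m i
  ... | inj₁ j = ⊆L ∘ inj₁ ∘ As⊑A j
  ... | inj₂ j = ⊆L ∘ inj₂ ∘ Bs⊑B j

  QL : ∀ i → Q (Ls i)
  QL i with splitAt m i
  ... | inj₁ j = QA j
  ... | inj₂ j = QB j

  covers : A ∪ᶜ B ⊑ ⋃ᶜ Ls
  covers {F} (inj₁ F∈A) with j , F∈ ← A⊆ F∈A = j ↑ˡ n ,
    subst (λ s → F ∈ simplices ([ As , Bs ]′ s)) (sym (splitAt-↑ˡ m j n)) F∈
  covers {F} (inj₂ F∈B) with j , F∈ ← B⊆ F∈B = m ↑ʳ j ,
    subst (λ s → F ∈ simplices ([ As , Bs ]′ s)) (sym (splitAt-↑ʳ m n j)) F∈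

complexity-bounds : (em : ExcludedMiddle (suc (suc ℓ)))
  {V : Set ℓ} (Q : SimplicialComplex V → Set (suc ℓ)) → Hereditary Q →
  (L A B : SimplicialComplex V) →
  IsFacetSubcomplex A L → IsFacetSubcomplex B L → L ≋ A ∪ᶜ B →
  let c = λ K → leastPositive em (Decomposition K Q) in
  (c A ⊔∞ c B ≤∞ c L) × (c L ≤∞ c A +∞ c B)
complexity-bounds em Q her L A B A≤L B≤L L≋A∪B =
  ⊔∞-lub (leastPositive-mono em (decomposition-restrict em Q her A L A≤L))
         (leastPositive-mono em (decomposition-restrict em Q her B L B≤L)) ,
  leastPositive-+ em (decomposition-∪ Q L A B L≋A∪B)

module _ {V W : Set ℓ} (H : SimplicialComplex W) where

  restrict : (A L : SimplicialComplex V) → A ⊑ L → VertexMap L H → VertexMap A H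
  restrict A L A⊑L f = record
    { to   = λ (v , F , F∈A , v∈F) → Func.to f (v , F , A⊑L F∈A , v∈F)
    -- Vertices are compared by their underlying points only, so equality is the same in `A` and in
    -- `L`.
    ; cong = Func.cong f
    }

  -- The image of `F` under the restricted map is definitionally its image under `f`, with `F`
  -- regarded as a simplex of `L`.
  restrict-isFacetSimplicial : (A L : SimplicialComplex V)
    ((A⊑L , _) : IsFacetSubcomplex A L) (f : VertexMap L H) →
    IsFacetSimplicial L H f →
    IsFacetSimplicial A H (restrict A L A⊑L f)
  restrict-isFacetSimplicial A L (A⊑L , facet) f (simplicial , facets) =
    (λ F∈A → simplicial (A⊑L F∈A)) ,
    λ F∈A F-facet → facets (A⊑L F∈A) (facet F-facet)

  facetMap-hereditary : Hereditary (λ L → FacetMap L H)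
  facetMap-hereditary A L A≤L (f , f-facet) =
    restrict A L (proj₁ A≤L) f ,
    restrict-isFacetSimplicial A L A≤L f f-facet

  injectiveFacetMap-hereditary : Hereditary (λ L → InjectiveFacetMap L H)
  injectiveFacetMap-hereditary A L A≤L (f , f-facet , injective) =
    restrict A L (proj₁ A≤L) f ,
    restrict-isFacetSimplicial A L A≤L f f-facet , injective

theorem3p11 : {ℓ : Level} (em : ExcludedMiddle (suc (suc ℓ)))
    {V W : Set ℓ} (L : SimplicialComplex V) (H : SimplicialComplex W)
    (A B : SimplicialComplex V) →
    IsFacetSubcomplex A L → IsFacetSubcomplex B L → L ≋ A ∪ᶜ B →
    ((C em A H ⊔∞ C em B H ≤∞ C em L H) ×
    (C em L H ≤∞ C em A H +∞ C em B H)) ×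
    ((IC em A H ⊔∞ IC em B H ≤∞ IC em L H) ×
    (IC em L H ≤∞ IC em A H +∞ IC em B H))
theorem3p11 em L H A B A≤L B≤L L≋A∪B =
  complexity-bounds em _ (facetMap-hereditary H) L A B A≤L B≤L L≋A∪B ,
  complexity-bounds em _ (injectiveFacetMap-hereditary H) L A B A≤L B≤L L≋A∪B
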